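{- Let $G=(V,E,T,\zeta_v,\zeta_e)$ be a dynamic graph whose time set $T$ is totally ordered by $<_T$, let $f:\mathbb{N}\to\mathbb{N}$ be a function such that $\operatorname{ltw}(G_t,r)\le f(r)$ for every $t\in T$ and every $r\in\mathbb{N}$, and let $\mathcal{G}$ be the Gaifman graph of the local treewidth preserving structure $\mathcal{A}(G)$ with linear time relation $R$. Then $\operatorname{ltw}(\mathcal{G},r)\le f(r)$ for every $r\in\mathbb{N}$. (If $f$ is computable, this is an effective bound on the local treewidth of $\mathcal{G}$.)
   Context: A dynamic graph $G=(V,E,T,\zeta_v,\zeta_e)$ consists of a finite vertex set $V$, an edge set $E\subset V\times V$ without loops (simple graphs, directed or undirected), a finite set $T=T(G)$ of times with an order relation $<_T$, and functions $\zeta_v:V\to 2^T$, $\zeta_e:E\to 2^T$ giving the times at which vertices and edges exist. An edge exists only when both its endpoints do: $\zeta_e(uv)\subseteq\zeta_v(u)\cap\zeta_v(v)$. The snapshot $G_t$ is the static graph with vertices $\{v: t\in\zeta_v(v)\}$ and edges $\{uv: t\in\zeta_e(uv)\}$. For a graph $H$ and $r\in\mathbb{N}$, $\operatorname{ltw}(H,r)=\max_{v\in V(H)}\operatorname{tw}(H[N_r(v)])$, where $N_r(v)$ is the set of vertices at distance at most $r$ from $v$ and $\operatorname{tw}$ is treewidth (of the underlying undirected graph). Local treewidth preserving structure $\mathcal{A}(G)$ with linear time relation: the universe consists of an element $v^t$ for each $v\in V$ and $t\in\zeta_v(v)$, an element for each $t\in T$, and an additional constant $s$. There is an auxiliary function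 $f_V$ (not a relation of the vocabulary) with $f_V(v^t)=f_V(u^{t'})$ if and only if $v^t$ and $u^{t'}$ are derived from the same vertex of $G$. The vocabulary consists of: $V$ (unary, true of all elements $v^t$); $E$ (binary, true of $(u^t,v^t)$ when $uv\in E$ and $t\in\zeta_e(uv)$); $T$ (unary, true of the time elements); $R$ (binary, true of $(t_1,t_2)$ with $t_1,t_2\in T$ iff $t_1$ immediately precedes $t_2$ in the total order, and of $(s,t)$ iff $t$ is the earliest time element); and for each $t\in T$ a relation $L_t$, true of the vertex elements $v^t$ with $t\in\zeta_v(v)$ and (as a binary relation denoted by the same symbol) of the pairs $(u^t,v^t)$ with $t\in\zeta_e(uv)$. The Gaifman graph of a structure has the universe as vertex set, with two distinct elements adjacent iff they occur together in some tuple of some relation of the vocabulary.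
   Formalization: It is additionally assumed that f(r) ≥ 1 for all r ≥ 1; without this the claim fails, e.g. for V empty, |T| = 1 and f = 0, since the Gaifman graph then has the edge between s and the earliest time element. -}

module Defs where

open import Level using (0ℓ)
open import Data.Bool.Base using (Bool; T)
open import Data.Fin.Base using (Fin)
open import Data.List.Base using (List; _∷_; _∷ʳ_; length)
open import Data.List.Membership.Propositional using (_∈_)
open import Data.List.Relation.Unary.Linked using (Linked)
open import Data.List.Relation.Unary.Unique.Propositional using (Unique)
open import Data.Maybe.Base using (Maybe; just; nothing)
open import Data.Nat.Base using (ℕ; suc; pred; _≤_; _⊔_; NonZero)
open import Data.Nat.Properties using (≤-trans)
open import Data.Product.Base using (∃-syntax; Σ-syntax; _×_; _,_; proj₁; proj₂)
open import Data.Unit.Base using (⊤; tt)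
import Data.Vec.Functional as Vector
open import Data.Vec.Base using (Vec; []; _∷_)
open import Data.Vec.Membership.Propositional using () renaming (_∈_ to _∈ᵛ_)
open import Function.Base using (_∘_)
open import Function.Bundles using (_↔_; _⇔_; mk⇔; Equivalence)
open import Relation.Binary.Construct.Closure.ReflexiveTransitive using (Star; fold)
open import Relation.Binary.Construct.Closure.Symmetric using (SymClosure)
open import Relation.Binary.Core using (Rel)
open import Relation.Binary.Definitions using (Symmetric)
open import Relation.Binary.PropositionalEquality.Core using (_≡_; _≢_; refl)
open import Relation.Binary.Structures using (IsStrictPartialOrder)
open import Relation.Nullary.Negation.Core using (¬_)
open import Relation.Unary using (Pred; _∩_)

-- Simple graphs, directed or undirected; the undirected ones are those with a
-- symmetric edge relation.  The vertices form a subset of an ambient type, so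
-- that an induced subgraph does not change the type of vertices.

record Graph (A : Set) : Set₁ where
  field
    V        : Pred A 0ℓ
    E        : Rel A 0ℓ
    E⊆V×V    : ∀ {u v} → E u v → V u × V v
    loopless : ∀ {v} → ¬ E v v

open Graph

infix 20 _[_]

_[_] : ∀ {A} → Graph A → Pred A 0ℓ → Graph A
H [ S ] = record
  { V        = V H ∩ S
  ; E        = λ u v → E H u v × S u × S v
  ; E⊆V×V    = λ (e , Su , Sv) → (proj₁ (E⊆V×V H e) , Su) , (proj₂ (E⊆V×V H e) , Sv)
  ; loopless = λ (e , _) → loopless H e
  }

-- Distances and neighbourhoods are those of the underlying undirected graph.

Walk : ∀ {A} → Graph A → Rel A 0ℓ
Walk H = Star (SymClosure (E H))

walkLength : ∀ {A} (H : Graph A) {u v : A} → Walk H u v → ℕ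
walkLength H = fold (λ _ _ → ℕ) (λ _ → suc) 0

N : ∀ {A} → Graph A → ℕ → A → Pred A 0ℓ
N H r v u = V H u × Σ[ w ∈ Walk H v u ] walkLength H w ≤ r

IsCycle : ∀ {A : Set} → Rel A 0ℓ → A → List A → Set
IsCycle _~_ x xs = Unique (x ∷ xs) × 3 ≤ length (x ∷ xs) × Linked _~_ ((x ∷ xs) ∷ʳ x)

record Tree : Set₁ where
  field
    size      : ℕ
    nonempty  : NonZero size
    _~_       : Rel (Fin size) 0ℓ
    ~-sym     : Symmetric _~_
    ~-irrefl  : ∀ {i} → ¬ (i ~ i)
    connected : ∀ i j → Star _~_ i j
    acyclic   : ∀ i is → ¬ IsCycle _~_ i is

  Node : Set
  Node = Fin size

-- A bag is a finite set, given as a list without repetitions.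

record TreeDecomposition {A : Set} (H : Graph A) : Set₁ where
  field
    tree         : Tree
  open Tree tree public
  field
    bag          : Node → List A
    bag-unique   : ∀ i → Unique (bag i)
    bag⊆V        : ∀ i {v} → v ∈ bag i → V H v
    vertex-cover : ∀ {v} → V H v → ∃[ i ] v ∈ bag i
    edge-cover   : ∀ {u v} → E H u v → ∃[ i ] (u ∈ bag i × v ∈ bag i)
    coherent     : ∀ v {i j} → v ∈ bag i → v ∈ bag j →
                   Star (λ k l → k ~ l × v ∈ bag k × v ∈ bag l) i j

  -- Largest bag size minus one; pred cuts off at 0 only if H has no vertices.

  width : ℕ
  width = pred (Vector.foldr _⊔_ 0 (length ∘ bag))

-- The treewidth is the minimum of the widths of the tree decompositions, and
-- the local treewidth is a maximum of treewidths.  Neither is available as a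
-- function without deciding which widths occur, so each is given as the graph
-- of a partial function, together with the relation "at most k" it induces
-- (a minimum is ≤ k iff some member is, a maximum is ≤ k iff all members are).

IsTreewidth : ∀ {A} → Graph A → ℕ → Set₁
IsTreewidth H w =
  (∃[ D ] TreeDecomposition.width {H = H} D ≡ w) ×
  (∀ (D : TreeDecomposition H) → w ≤ TreeDecomposition.width D)

tw[_]≤_ : ∀ {A} → Graph A → ℕ → Set₁
tw[ H ]≤ k = ∃[ D ] TreeDecomposition.width {H = H} D ≤ k

IsLocalTreewidth : ∀ {A} → Graph A → ℕ → ℕ → Set₁
IsLocalTreewidth H r m =
  (∃[ v ] (V H v × IsTreewidth (H [ N H r v ]) m)) ×
  (∀ v → V H v → ∃[ w ] (IsTreewidth (H [ N H r v ]) w × w ≤ m))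

ltw[_,_]≤_ : ∀ {A} → Graph A → ℕ → ℕ → Set₁
ltw[ H , r ]≤ k = ∀ v → V H v → tw[ H [ N H r v ] ]≤ k

tw≤⇔ : ∀ {A} {H : Graph A} {w k} → IsTreewidth H w → (tw[ H ]≤ k) ⇔ (w ≤ k)
tw≤⇔ ((D , refl) , min) = mk⇔ (λ (D′ , D′≤k) → ≤-trans (min D′) D′≤k) (D ,_)

ltw≤⇔ : ∀ {A} {H : Graph A} {r m k} → IsLocalTreewidth H r m →
        (ltw[ H , r ]≤ k) ⇔ (m ≤ k)
ltw≤⇔ ((v , v∈V , tw-v) , ub) = mk⇔
  (λ all → Equivalence.to (tw≤⇔ tw-v) (all v v∈V))
  (λ m≤k u u∈V → let (_ , tw-u , w≤m) = ub u u∈V in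
                 Equivalence.from (tw≤⇔ tw-u) (≤-trans w≤m m≤k))

𝒫 : Set → Set
𝒫 X = X → Bool

infix 4 _∈ˢ_

_∈ˢ_ : ∀ {X} → X → 𝒫 X → Set
x ∈ˢ S = T (S x)

Finite : Set → Set
Finite X = ∃[ n ] (X ↔ Fin n)

record DynamicGraph : Set₁ where
  infix 4 _<ₜ_
  field
    Vertex               : Set
    Vertex-finite        : Finite Vertex
    Edge                 : 𝒫 (Vertex × Vertex)
    Edge-loopless        : ∀ {v} → ¬ ((v , v) ∈ˢ Edge)
    Time                 : Set
    Time-finite          : Finite Time
    _<ₜ_                 : Rel Time 0ℓ
    isStrictPartialOrder : IsStrictPartialOrder _≡_ _<ₜ_
    ζᵥ                   : Vertex → 𝒫 Time
    ζₑ                   : ∀ {u v} → (u , v) ∈ˢ Edge → 𝒫 Time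
    ζₑ⊆ζᵥ∩ζᵥ             : ∀ {u v} (e : (u , v) ∈ˢ Edge) {t} →
                           t ∈ˢ ζₑ e → t ∈ˢ ζᵥ u × t ∈ˢ ζᵥ v

snapshot : (G : DynamicGraph) → DynamicGraph.Time G → Graph (DynamicGraph.Vertex G)
snapshot G t = record
  { V        = λ v → t ∈ˢ ζᵥ v
  ; E        = λ u v → Σ[ e ∈ (u , v) ∈ˢ Edge ] t ∈ˢ ζₑ e
  ; E⊆V×V    = λ (e , t∈e) → ζₑ⊆ζᵥ∩ζᵥ e t∈e
  ; loopless = λ (e , _) → Edge-loopless e
  }
  where open DynamicGraph G

record Vocabulary : Set₁ where
  field
    Relation : Set
    arity    : Relation → ℕ
    Constant : Set

record Structure (τ : Vocabulary) : Set₁ where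
  open Vocabulary τ
  field
    Universe : Set
    ⟦_⟧      : (R : Relation) → Pred (Vec Universe (arity R)) 0ℓ
    ⟦_⟧ᶜ     : Constant → Universe

gaifman : ∀ {τ} (𝔄 : Structure τ) → Graph (Structure.Universe 𝔄)
gaifman {τ} 𝔄 = record
  { V        = λ _ → ⊤
  ; E        = λ a b → a ≢ b × Σ[ R ∈ Relation ] Σ[ as ∈ Vec Universe (arity R) ]
                         (⟦ R ⟧ as × a ∈ᵛ as × b ∈ᵛ as)
  ; E⊆V×V    = λ _ → tt , tt
  ; loopless = λ (a≢a , _) → a≢a refl
  }
  where
  open Vocabulary τ
  open Structure 𝔄

module LocalTreewidthPreserving (G : DynamicGraph) where
  open DynamicGraph G

  -- The symbol L_t is used both as a unary and as a binary relation.

  data Symbol : Set where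
    `V `E `T `R : Symbol
    `L₁ `L₂     : Time → Symbol

  vocabulary : Vocabulary
  vocabulary = record
    { Relation = Symbol
    ; arity    = λ { `V → 1 ; `E → 2 ; `T → 1 ; `R → 2 ; (`L₁ _) → 1 ; (`L₂ _) → 2 }
    ; Constant = ⊤
    }

  -- vertex v t _ is the element v^t.

  data Element : Set where
    vertex : (v : Vertex) (t : Time) → t ∈ˢ ζᵥ v → Element
    time   : Time → Element
    s      : Element

  -- The auxiliary function f_V, which is not part of the vocabulary.

  f-V : Element → Maybe Vertex
  f-V (vertex v _ _) = just v
  f-V (time _)       = nothing
  f-V s              = nothing

  data IsVertex : Pred Element 0ℓ where
    isVertex : ∀ {v t p} → IsVertex (vertex v t p)

  data IsTime : Pred Element 0ℓ where
    isTime : ∀ {t} → IsTime (time t)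

  data IsVertexAt (t : Time) : Pred Element 0ℓ where
    isVertexAt : ∀ {v p} → IsVertexAt t (vertex v t p)

  data IsEdgeAt (t : Time) : Rel Element 0ℓ where
    isEdgeAt : ∀ {u v p q} (e : (u , v) ∈ˢ Edge) → t ∈ˢ ζₑ e →
               IsEdgeAt t (vertex u t p) (vertex v t q)

  ImmediatelyPrecedes : Rel Time 0ℓ
  ImmediatelyPrecedes t₁ t₂ = t₁ <ₜ t₂ × (∀ t → ¬ (t₁ <ₜ t × t <ₜ t₂))

  Earliest : Pred Time 0ℓ
  Earliest t = ∀ t′ → t′ ≢ t → t <ₜ t′

  data Succession : Rel Element 0ℓ where
    next  : ∀ {t₁ t₂} → ImmediatelyPrecedes t₁ t₂ → Succession (time t₁) (time t₂)
    first : ∀ {t} → Earliest t → Succession s (time t)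

  interpretation : (R : Symbol) → Pred (Vec Element (Vocabulary.arity vocabulary R)) 0ℓ
  interpretation `V      (a ∷ [])     = IsVertex a
  interpretation `E      (a ∷ b ∷ []) = ∃[ t ] IsEdgeAt t a b
  interpretation `T      (a ∷ [])     = IsTime a
  interpretation `R      (a ∷ b ∷ []) = Succession a b
  interpretation (`L₁ t) (a ∷ [])     = IsVertexAt t a
  interpretation (`L₂ t) (a ∷ b ∷ []) = IsEdgeAt t a b

  𝒜 : Structure vocabulary
  𝒜 = record
    { Universe = Element
    ; ⟦_⟧      = interpretation
    ; ⟦_⟧ᶜ     = λ _ → s
    }

open LocalTreewidthPreserving public using (𝒜)

{-# OPTIONS --safe #-}

-- Every tuple of 𝒜(G) with two distinct entries relates either two vertex
-- elements of the same time or two elements of the path s, t₁, …, tₙ, so the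
-- Gaifman graph is the disjoint union of the snapshots and of this path.  The
-- ball around an element lies in its component: for v^t it is the ball around v
-- in G_t, and on the path it has treewidth at most 1, and 0 for radius 0.

module Submission where

open import Defs
open import Level using (0ℓ)
open import Data.Bool.Properties using (T-irrelevant)
open import Data.Empty using (⊥)
open import Data.Fin.Base using (Fin; zero; suc)
open import Data.Fin.Induction using (spo-wellFounded; spo-noetherian)
import Data.Fin.Properties as Fin
open import Data.List.Base using (List; []; _∷_; _∷ʳ_; length)
open import Data.List.Membership.Propositional using (_∈_)
open import Data.List.Relation.Unary.All as All using ([]; _∷_)
open import Data.List.Relation.Unary.AllPairs using ([]; _∷_)
open import Data.List.Relation.Unary.Any using (here; there)
open import Data.List.Relation.Unary.Linked as Linked using (Linked; _∷_)
open import Data.List.Relation.Unary.Unique.Propositional using (Unique)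
open import Data.Nat.Base using (ℕ; zero; suc; pred; _≤_; _⊔_; z≤n; s≤s)
open import Data.Nat.Properties
  using (≤-trans; pred-mono-≤; m≤m⊔n; m≤n⊔m; ⊔-lub; m≤n⇒m≤1+n)
open import Data.Product.Base using (∃-syntax; Σ-syntax; _×_; _,_; proj₁; proj₂)
open import Data.Sum.Base using (_⊎_; inj₁; inj₂)
open import Data.Unit.Base using (⊤; tt)
open import Data.Vec.Base using ([]; _∷_)
open import Data.Vec.Membership.Propositional using () renaming (_∈_ to _∈ᵛ_)
open import Data.Vec.Relation.Unary.Any using (here; there)
import Data.Vec.Functional as Vector
open import Function.Base using (_∘_; flip)
open import Function.Bundles using (_⇔_; mk⇔; Equivalence; Inverse)
open import Induction.WellFounded using (Acc; acc)
open import Relation.Binary.Construct.Closure.ReflexiveTransitive as Star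
  using (Star; ε; _◅_; _◅◅_)
open import Relation.Binary.Construct.Closure.Symmetric as Sym using (SymClosure; fwd; bwd)
open import Relation.Binary.Core using (Rel)
open import Relation.Binary.Definitions using (Decidable; Transitive; Trichotomous; tri<; tri≈; tri>)
open import Relation.Binary.PropositionalEquality.Core using (_≡_; _≢_; refl; sym; trans; cong; subst)
open import Relation.Binary.PropositionalEquality.Properties using (isEquivalence)
open import Relation.Binary.Structures using (IsStrictTotalOrder)
open import Relation.Binary.Structures.Biased using (isStrictTotalOrderᶜ)
open import Relation.Nullary.Decidable using (Dec; yes; no; map′; ¬?; _×-dec_; _⊎-dec_)
open import Relation.Nullary.Negation using (¬_; contradiction)

open Graph

-- Bounding widths through bag sizes.

⊔-max-≤⇔ : ∀ {n k} (g : Fin n → ℕ) → (Vector.foldr _⊔_ 0 g ≤ k) ⇔ (∀ i → g i ≤ k)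
⊔-max-≤⇔ g = mk⇔ (to g) (from g)
  where
  to : ∀ {n k} (g : Fin n → ℕ) → Vector.foldr _⊔_ 0 g ≤ k → ∀ i → g i ≤ k
  to g p zero    = ≤-trans (m≤m⊔n _ _) p
  to g p (suc i) = to (g ∘ suc) (≤-trans (m≤n⊔m (g zero) _) p) i
  from : ∀ {n k} (g : Fin n → ℕ) → (∀ i → g i ≤ k) → Vector.foldr _⊔_ 0 g ≤ k
  from {zero}  g p = z≤n
  from {suc n} g p = ⊔-lub (p zero) (from (g ∘ suc) (p ∘ suc))

width≤⇔ : ∀ {A} {H : Graph A} (D : TreeDecomposition H) {k} → let open TreeDecomposition D in
          (width ≤ k) ⇔ (∀ i → length (bag i) ≤ suc k)
width≤⇔ D = mk⇔
  (λ w≤k → Equivalence.to (⊔-max-≤⇔ (length ∘ bag)) (≤suc w≤k))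
  (λ bag≤ → pred-mono-≤ (Equivalence.from (⊔-max-≤⇔ (length ∘ bag)) bag≤))
  where
  open TreeDecomposition D
  ≤suc : ∀ {m k} → pred m ≤ k → m ≤ suc k
  ≤suc {zero}  _ = z≤n
  ≤suc {suc _} p = s≤s p

tw-mono : ∀ {A} {H : Graph A} {k l} → k ≤ l → tw[ H ]≤ k → tw[ H ]≤ l
tw-mono k≤l (D , w≤k) = D , ≤-trans w≤k k≤l

-- Transfer of tree decompositions along partial injections.

module _ {A B : Set} {_↦_ : A → B → Set}
         (functional : ∀ {a b b′} → a ↦ b → a ↦ b′ → b ≡ b′)
         (injective : ∀ {a a′ b} → a ↦ b → a′ ↦ b → a ≡ a′)
         where

  -- A relation offers no map to apply, so the list is scanned and each entry is replaced by its
  -- partner or dropped. Injectivity keeps the partners distinct, and functionality makes the one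
  -- found the only one.
  image : ∀ {xs} → Unique xs → (∀ {a} → a ∈ xs → Dec (∃[ b ] a ↦ b)) →
          ∃[ ys ] (Unique ys × length ys ≤ length xs ×
                   (∀ {b} → b ∈ ys → ∃[ a ] (a ∈ xs × a ↦ b)) ×
                   (∀ {a b} → a ∈ xs → a ↦ b → b ∈ ys))
  image {[]} _ _ = [] , [] , z≤n , (λ ()) , λ ()
  image {x ∷ xs} (x∉xs ∷ uniq) dom? with image uniq (dom? ∘ there) | dom? (here refl)
  ... | ys , uniq′ , len , back , forth | no x-undef =
    ys , uniq′ , m≤n⇒m≤1+n len ,
    (λ b∈ → let (a , a∈ , a↦b) = back b∈ in a , there a∈ , a↦b) ,
    λ { (here refl) x↦b → contradiction (_ , x↦b) x-undef ; (there a∈) → forth a∈ }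
  ... | ys , uniq′ , len , back , forth | yes (y , x↦y) =
    y ∷ ys ,
    All.tabulate (λ { y∈ refl → let (_ , a∈ , a↦y) = back y∈ in
                                All.lookup x∉xs a∈ (injective x↦y a↦y) }) ∷ uniq′ ,
    s≤s len ,
    (λ { (here refl) → x , here refl , x↦y
       ; (there b∈) → let (a , a∈ , a↦b) = back b∈ in a , there a∈ , a↦b }) ,
    λ { (here refl) x↦b → here (functional x↦b x↦y) ; (there a∈) a↦b → there (forth a∈ a↦b) }

  -- Up to renaming, `K` is a subgraph of `H`, so the tree stays and every bag is replaced by its
  -- image. Deciding the domain makes the image a list; edges may change orientation, since bags
  -- ignore it.
  tw-embed : ∀ {H : Graph A} {K : Graph B} {k} →
             (∀ {a} → V H a → Dec (∃[ b ] a ↦ b)) →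
             (∀ {a b} → V H a → a ↦ b → V K b) →
             (∀ {b} → V K b → ∃[ a ] (V H a × a ↦ b)) →
             (∀ {b b′} → E K b b′ → ∃[ a ] ∃[ a′ ] (a ↦ b × a′ ↦ b′ × SymClosure (E H) a a′)) →
             tw[ H ]≤ k → tw[ K ]≤ k
  tw-embed {H} {K} dom? range onto edge (D , w≤k) =
    D′ , Equivalence.from (width≤⇔ D′)
           (λ i → ≤-trans (proj₁ (proj₂ (proj₂ (bag-image i)))) (Equivalence.to (width≤⇔ D) w≤k i))
    where
    open TreeDecomposition D
    bag-image = λ i → image (bag-unique i) (λ {a} (a∈ : a ∈ bag i) → dom? (bag⊆V i a∈))
    bag′ = λ i → proj₁ (bag-image i)
    back : ∀ i {b} → b ∈ bag′ i → ∃[ a ] (a ∈ bag i × a ↦ b)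
    back i = proj₁ (proj₂ (proj₂ (proj₂ (bag-image i))))
    forth : ∀ i {a b} → a ∈ bag i → a ↦ b → b ∈ bag′ i
    forth i = proj₂ (proj₂ (proj₂ (proj₂ (bag-image i))))
    D′ : TreeDecomposition K
    D′ = record
      { tree         = tree
      ; bag          = bag′
      ; bag-unique   = λ i → proj₁ (proj₂ (bag-image i))
      ; bag⊆V        = λ i b∈ → let (_ , a∈ , a↦b) = back i b∈ in range (bag⊆V i a∈) a↦b
      ; vertex-cover = λ b∈V → let (_ , a∈V , a↦b) = onto b∈V ; (i , a∈) = vertex-cover a∈V in
                               i , forth i a∈ a↦b
      ; edge-cover   = λ e → let (_ , _ , a↦b , a′↦b′ , e′) = edge e in cover a↦b a′↦b′ e′
      ; coherent     = λ b {i} {j} b∈i b∈j → let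
          (a , a∈i , a↦b) = back i b∈i
          (_ , a′∈j , a′↦b) = back j b∈j
          -- The preimages found in the two bags coincide by injectivity, so the coherence of this
          -- one vertex of `H` gives the path.
          a∈j = subst (_∈ bag j) (injective a′↦b a↦b) a′∈j
          in Star.map (λ {k} {l} (k~l , a∈k , a∈l) → k~l , forth k a∈k a↦b , forth l a∈l a↦b)
                      (coherent a a∈i a∈j)
      }
      where
      cover : ∀ {a a′ b b′} → a ↦ b → a′ ↦ b′ → SymClosure (E H) a a′ →
              ∃[ i ] (b ∈ bag′ i × b′ ∈ bag′ i)
      cover a↦b a′↦b′ (fwd e) = let (i , a∈ , a′∈) = edge-cover e in
                                i , forth i a∈ a↦b , forth i a′∈ a′↦b′
      cover a↦b a′↦b′ (bwd e) = let (i , a′∈ , a∈) = edge-cover e in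
                                i , forth i a∈ a↦b , forth i a′∈ a′↦b′

-- Balls under step-by-step simulation.

Adj : ∀ {A} → Graph A → Rel A 0ℓ
Adj H = SymClosure (E H)

-- Required in both directions, this says that the related vertices on each side are closed under
-- adjacency, with matching edges: they form unions of connected components.
Simulates : ∀ {A B} → (A → B → Set) → Graph A → Graph B → Set
Simulates _↦_ H K = ∀ {a a′ b} → Adj H a a′ → a ↦ b → ∃[ b′ ] (a′ ↦ b′ × Adj K b b′)

walk-lift : ∀ {A B} {_↦_ : A → B → Set} (H : Graph A) (K : Graph B) →
            Simulates _↦_ H K → ∀ {a a′ b r} → a ↦ b → (w : Walk H a a′) → walkLength H w ≤ r →
            ∃[ b′ ] (a′ ↦ b′ × (Σ[ w′ ∈ Walk K b b′ ] walkLength K w′ ≤ r))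
walk-lift H K sim a↦b ε le = _ , a↦b , ε , z≤n
walk-lift H K sim a↦b (e ◅ w) (s≤s le) =
  let (_ , c↦d , e′) = sim e a↦b
      (b′ , a′↦b′ , w′ , le′) = walk-lift H K sim c↦d w le
  in b′ , a′↦b′ , e′ ◅ w′ , s≤s le′

-- Walks transfer both ways without growing longer, so the ball around `a` corresponds exactly to
-- the ball around `b`, and `tw-embed` carries the decomposition over.
tw-component : ∀ {A B} {_↦_ : A → B → Set} {H : Graph A} {K : Graph B} →
  (∀ {a b b′} → a ↦ b → a ↦ b′ → b ≡ b′) →
  (∀ {a a′ b} → a ↦ b → a′ ↦ b → a ≡ a′) →
  (∀ {a} → V H a → ∃[ b ] a ↦ b) →
  (∀ {a b} → a ↦ b → V H a × V K b) →
  Simulates _↦_ H K → Simulates (flip _↦_) K H →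
  ∀ {a b} r {k} → a ↦ b → tw[ H [ N H r a ] ]≤ k → tw[ K [ N K r b ] ]≤ k
tw-component {_↦_ = _↦_} {H} {K} functional injective total ↦⇒V lift reflect {a} {b} r a↦b =
  tw-embed functional injective
    (λ (x∈V , _) → yes (total x∈V))
    (λ { (_ , _ , w , w≤r) x↦y →
         let (y′ , x↦y′ , w′) = walk-lift H K lift a↦b w w≤r
             y∈V = proj₂ (↦⇒V x↦y)
         in y∈V , y∈V , subst (λ y → Σ[ w ∈ Walk K b y ] walkLength K w ≤ r)
                              (functional x↦y′ x↦y) w′ })
    (λ (_ , y∈N) → let (x , x↦y , x∈N) = pull y∈N in x , (proj₁ x∈N , x∈N) , x↦y)
    (λ { (e , y∈N , y′∈N) →
         let (x , x↦y , x∈N) = pull y∈N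
             (x′ , x′↦y′ , x′∈N) = pull y′∈N
             -- `reflect` supplies some partner of `y′`; injectivity identifies it with `x′`, which
             -- is known to lie in the ball.
             (x″ , x″↦y′ , e′) = reflect (fwd e) x↦y
         in x , x′ , x↦y , x′↦y′ ,
            induced x∈N x′∈N (subst (Adj H x) (injective x″↦y′ x′↦y′) e′) })
  where
  pull : ∀ {y} → N K r b y → ∃[ x ] (x ↦ y × N H r a x)
  pull (_ , w , w≤r) =
    let (x , x↦y , w′) = walk-lift K H reflect a↦b w w≤r in x , x↦y , proj₁ (↦⇒V x↦y) , w′
  induced : ∀ {x x′} → N H r a x → N H r a x′ → Adj H x x′ → Adj (H [ N H r a ]) x x′
  induced p q (fwd e) = fwd (e , p , q)
  induced p q (bwd e) = bwd (e , q , p)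

-- Induced subgraphs, one-vertex graphs and decidable balls.

-- Equality restricted to `S` is a partial injection; deciding `S` tells which vertices to strike
-- from the bags.
tw-induced : ∀ {A} {H : Graph A} {S : A → Set} {k} → (∀ a → Dec (S a)) →
             tw[ H ]≤ k → tw[ H [ S ] ]≤ k
tw-induced {S = S} S? = tw-embed {_↦_ = λ a b → a ≡ b × S b}
  (λ { (refl , _) (refl , _) → refl }) (λ { (refl , _) (refl , _) → refl })
  (λ {a} _ → map′ (λ Sa → a , refl , Sa) (λ { (_ , refl , Sa) → Sa }) (S? a))
  (λ { a∈V (refl , Sa) → a∈V , Sa })
  (λ (a∈V , Sa) → _ , a∈V , refl , Sa)
  (λ (e , Sa , Sb) → _ , _ , (refl , Sa) , (refl , Sb) , fwd e)

singletonTree : Tree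
singletonTree = record
  { size      = 1
  ; nonempty  = _
  ; _~_       = λ _ _ → ⊥
  ; ~-sym     = λ ()
  ; ~-irrefl  = λ ()
  ; connected = λ { zero zero → ε }
  ; acyclic   = λ { i [] (_ , s≤s () , _) ; i (j ∷ js) (_ , _ , () ∷ _) }
  }

tw-singleton : ∀ {A} {H : Graph A} {c} → V H c → (∀ {v} → V H v → v ≡ c) → tw[ H ]≤ 0
tw-singleton {H = H} {c} c∈V only = record
  { tree         = singletonTree
  ; bag          = λ _ → c ∷ []
  ; bag-unique   = λ _ → [] ∷ []
  ; bag⊆V        = λ { _ (here refl) → c∈V }
  ; vertex-cover = λ v∈V → zero , here (only v∈V)
  ; edge-cover   = λ e → zero , here (only (proj₁ (E⊆V×V H e))) , here (only (proj₂ (E⊆V×V H e)))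
  ; coherent     = λ { v {zero} {zero} _ _ → ε }
  } , z≤n

ltw-0 : ∀ {A} (H : Graph A) → ltw[ H , 0 ]≤ 0
ltw-0 H c c∈V = tw-singleton (c∈V , c∈V , ε , z≤n) (λ { (_ , _ , ε , _) → refl })

-- Makes balls eligible for `tw-induced`. In a walk that is not empty, the first step leads to one
-- of finitely many vertices, and the rest has a smaller length bound.
walk≤? : ∀ {m} (H : Graph (Fin m)) → Decidable (E H) → ∀ r i j →
         Dec (Σ[ w ∈ Walk H i j ] walkLength H w ≤ r)
walk≤? H E? zero i j =
  map′ (λ { refl → ε , z≤n }) (λ { (ε , _) → refl }) (i Fin.≟ j)
walk≤? H E? (suc r) i j = map′
  (λ { (inj₁ refl) → ε , z≤n ; (inj₂ (_ , e , w , w≤r)) → e ◅ w , s≤s w≤r })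
  (λ { (ε , _) → inj₁ refl ; (e ◅ w , s≤s w≤r) → inj₂ (_ , e , w , w≤r) })
  (i Fin.≟ j ⊎-dec Fin.any? (λ k → Adj? i k ×-dec walk≤? H E? r k j))
  where
  Adj? : Decidable (Adj H)
  Adj? i j = map′ (λ { (inj₁ e) → fwd e ; (inj₂ e) → bwd e })
                  (λ { (fwd e) → inj₁ e ; (bwd e) → inj₂ e }) (E? i j ⊎-dec E? j i)

-- In a cycle all steps go in the direction of the first one, because a change
-- of direction would return to the node before the previous one.

no-monotone-cycle : ∀ {A : Set} {_⟶_ _<_ : Rel A 0ℓ} → (∀ {x y} → x ⟶ y → x < y) →
  Transitive _<_ → (∀ {x} → ¬ x < x) → (∀ {x y z} → x ⟶ z → y ⟶ z → x ≡ y) →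
  ∀ {x y} zs → x ⟶ y → ¬ IsCycle (SymClosure _⟶_) x (y ∷ zs)
no-monotone-cycle _ _ _ _ [] _ (_ , s≤s (s≤s ()) , _)
no-monotone-cycle {_⟶_ = _⟶_} {_<_} ⟶⇒< <-trans <-irrefl injective {x} (z ∷ zs) x⟶y
                  (((_ ∷ x≢z ∷ _) ∷ uniq) , _ , _ ∷ y~z ∷ linked) with y~z
... | bwd z⟶y = x≢z (injective x⟶y z⟶y)
... | fwd y⟶z = climb zs (⟶⇒< x⟶y) y⟶z uniq linked
  where
  climb : ∀ {a b} cs → x < a → a ⟶ b → Unique (a ∷ b ∷ cs) →
          Linked (SymClosure _⟶_) (b ∷ cs ∷ʳ x) → ⊥
  -- About the return to `x` only `x < a` is retained: a forward step closes an increasing loop, a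
  -- backward one makes `x` and `a` equal by injectivity.
  climb [] x<a a⟶b _ (fwd b⟶x ∷ _) = <-irrefl (<-trans x<a (<-trans (⟶⇒< a⟶b) (⟶⇒< b⟶x)))
  climb [] x<a a⟶b _ (bwd x⟶b ∷ _) = <-irrefl (subst (x <_) (injective a⟶b x⟶b) x<a)
  climb (c ∷ cs) x<a a⟶b ((_ ∷ a≢c ∷ _) ∷ _) (bwd c⟶b ∷ _) = a≢c (injective a⟶b c⟶b)
  climb (c ∷ cs) x<a a⟶b (_ ∷ uniq) (fwd b⟶c ∷ linked) =
    climb cs (<-trans x<a (⟶⇒< a⟶b)) b⟶c uniq linked

-- The Hasse diagram of a finite total order.

module FiniteChain {n} {_<_ : Rel (Fin (suc n)) 0ℓ} (<-sto : IsStrictTotalOrder _≡_ _<_) where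
  open IsStrictTotalOrder <-sto
    using (compare; _<?_; irrefl; asym; isStrictPartialOrder) renaming (trans to <-trans)

  infix 4 _⋖_

  -- The covering relation of the order, with betweenness as an existential so that `between?`
  -- decides it.
  _⋖_ : Rel (Fin (suc n)) 0ℓ
  i ⋖ j = i < j × ¬ (∃[ k ] (i < k × k < j))

  between? : ∀ i j → Dec (∃[ k ] (i < k × k < j))
  between? i j = Fin.any? (λ k → i <? k ×-dec k <? j)

  _⋖?_ : Decidable _⋖_
  i ⋖? j = i <? j ×-dec ¬? (between? i j)

  ⋖-injective : ∀ {i j k} → i ⋖ k → j ⋖ k → i ≡ j
  ⋖-injective {i} {j} (i<k , ¬i-k) (j<k , ¬j-k) with compare i j
  ... | tri< i<j _ _ = contradiction (j , i<j , j<k) ¬i-k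
  ... | tri≈ _ i≡j _ = i≡j
  ... | tri> _ _ j<i = contradiction (i , j<i , i<k) ¬j-k

  ⋖-deterministic : ∀ {i j k} → i ⋖ j → i ⋖ k → j ≡ k
  ⋖-deterministic {i} {j} {k} (i<j , ¬i-j) (i<k , ¬i-k) with compare j k
  ... | tri< j<k _ _ = contradiction (j , i<j , j<k) ¬i-k
  ... | tri≈ _ j≡k _ = j≡k
  ... | tri> _ _ k<j = contradiction (k , i<k , k<j) ¬i-j

  -- Starting from `i`, climb to an element in between as long as there is one; finiteness ends the
  -- climb just below `j`.
  predecessor : ∀ {i j} → i < j → ∃[ k ] (k ⋖ j)
  predecessor {i} = go (spo-noetherian isStrictPartialOrder i)
    where
    go : ∀ {i j} → Acc (flip _<_) i → i < j → ∃[ k ] (k ⋖ j)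
    go {i} {j} (acc rec) i<j with between? i j
    ... | no ¬i-j             = i , i<j , ¬i-j
    ... | yes (k , i<k , k<j) = go (rec i<k) k<j

  -- Descend from `j` by predecessors, which is well-founded. The descent cannot jump over `i`: a
  -- predecessor below `i` would leave `i` strictly between it and its cover.
  <⇒path : ∀ {i j} → i < j → Star (SymClosure _⋖_) i j
  <⇒path {j = j} = go (spo-wellFounded isStrictPartialOrder j)
    where
    go : ∀ {i j} → Acc _<_ j → i < j → Star (SymClosure _⋖_) i j
    go {i} (acc rec) i<j with predecessor i<j
    ... | k , k<j , ¬k-j with compare i k
    ...   | tri< i<k _ _  = go (rec k<j) i<k ◅◅ fwd (k<j , ¬k-j) ◅ ε
    ...   | tri≈ _ refl _ = fwd (k<j , ¬k-j) ◅ ε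
    ...   | tri> _ _ k<i  = contradiction (i , k<i , i<j) ¬k-j

  connected : ∀ i j → Star (SymClosure _⋖_) i j
  connected i j with compare i j
  ... | tri< i<j _ _  = <⇒path i<j
  ... | tri≈ _ refl _ = ε
  ... | tri> _ _ j<i  = Star.reverse (Sym.symmetric _⋖_) (<⇒path j<i)

  acyclic : ∀ i is → ¬ IsCycle (SymClosure _⋖_) i is
  acyclic i [] (_ , s≤s () , _)
  acyclic i (j ∷ js) cycle@(_ , _ , fwd i⋖j ∷ _) =
    no-monotone-cycle proj₁ <-trans (irrefl refl) ⋖-injective js i⋖j cycle
  acyclic i (j ∷ js) (uniq , len , linked@(bwd j⋖i ∷ _)) =
    -- A first step downwards is the same situation in the reversed order, where `⋖-deterministic`
    -- provides the injectivity.
    no-monotone-cycle {_<_ = flip _<_} proj₁ (flip <-trans) (irrefl refl) ⋖-deterministic js j⋖i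
      (uniq , len , Linked.map (λ { (fwd e) → bwd e ; (bwd e) → fwd e }) linked)

  hasseTree : Tree
  hasseTree = record
    { size      = suc n
    ; nonempty  = _
    ; _~_       = SymClosure _⋖_
    ; ~-sym     = Sym.symmetric _⋖_
    ; ~-irrefl  = λ { (fwd (i<i , _)) → irrefl refl i<i ; (bwd (i<i , _)) → irrefl refl i<i }
    ; connected = connected
    ; acyclic   = acyclic
    }

  hasse : Graph (Fin (suc n))
  hasse = record
    { V        = λ _ → ⊤
    ; E        = _⋖_
    ; E⊆V×V    = _
    ; loopless = λ (i<i , _) → irrefl refl i<i
    }

  -- The path is decomposed along itself: the bag at `j` holds `j` and its predecessor, if any. A
  -- vertex then occurs at its own node and possibly at its successor's, and these two are adjacent.
  tw-hasse : tw[ hasse ]≤ 1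
  tw-hasse = D , Equivalence.from (width≤⇔ D) bag≤2
    where
    bag : Fin (suc n) → List (Fin (suc n))
    bag j with Fin.any? (_⋖? j)
    ... | yes (i , _) = j ∷ i ∷ []
    ... | no _        = j ∷ []

    bag≤2 : ∀ j → length (bag j) ≤ 2
    bag≤2 j with Fin.any? (_⋖? j)
    ... | yes _ = s≤s (s≤s z≤n)
    ... | no _  = s≤s z≤n

    bag-unique : ∀ j → Unique (bag j)
    bag-unique j with Fin.any? (_⋖? j)
    ... | yes (i , i<j , _) = ((λ j≡i → irrefl (sym j≡i) i<j) ∷ []) ∷ [] ∷ []
    ... | no _              = [] ∷ []

    self∈bag : ∀ j → j ∈ bag j
    self∈bag j with Fin.any? (_⋖? j)
    ... | yes _ = here refl
    ... | no _  = here refl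

    ⋖⇒∈bag : ∀ {i j} → i ⋖ j → i ∈ bag j
    ⋖⇒∈bag {i} {j} i⋖j with Fin.any? (_⋖? j)
    ... | yes (_ , k⋖j) = there (here (⋖-injective i⋖j k⋖j))
    ... | no ¬⋖j        = contradiction (i , i⋖j) ¬⋖j

    ∈bag⇒ : ∀ {i j} → i ∈ bag j → i ≡ j ⊎ i ⋖ j
    ∈bag⇒ {j = j} i∈ with Fin.any? (_⋖? j) | i∈
    ... | yes _         | here i≡j          = inj₁ i≡j
    ... | yes (_ , k⋖j) | there (here refl) = inj₂ k⋖j
    ... | no _          | here i≡j          = inj₁ i≡j

    Within : Fin (suc n) → Rel (Fin (suc n)) 0ℓ
    Within v k l = SymClosure _⋖_ k l × v ∈ bag k × v ∈ bag l

    Within-sym : ∀ {v k l} → Within v k l → Within v l k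
    Within-sym (k~l , v∈k , v∈l) = Sym.symmetric _⋖_ k~l , v∈l , v∈k

    from-self : ∀ {v i} → v ∈ bag i → Star (Within v) v i
    from-self {v} v∈i with ∈bag⇒ v∈i
    ... | inj₁ refl = ε
    ... | inj₂ v⋖i  = (fwd v⋖i , self∈bag v , v∈i) ◅ ε

    D : TreeDecomposition hasse
    D = record
      { tree         = hasseTree
      ; bag          = bag
      ; bag-unique   = bag-unique
      ; bag⊆V        = _
      ; vertex-cover = λ {v} _ → v , self∈bag v
      ; edge-cover   = λ {_} {v} u⋖v → v , ⋖⇒∈bag u⋖v , self∈bag v
      ; coherent     = λ v v∈i v∈j → Star.reverse Within-sym (from-self v∈i) ◅◅ from-self v∈j
      }

  -- A ball of positive radius contains an edge as soon as the path does, so treewidth 1 must be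
  -- allowed there; at radius 0 `f` may vanish, and the one-vertex ball is treated separately.
  ltw-hasse : ∀ {f : ℕ → ℕ} → (∀ r → 1 ≤ r → 1 ≤ f r) → ∀ r → ltw[ hasse , r ]≤ f r
  ltw-hasse 1≤f zero    i i∈V = tw-mono z≤n (ltw-0 hasse i i∈V)
  ltw-hasse 1≤f (suc r) i _   = tw-mono (1≤f (suc r) (s≤s z≤n))
    (tw-induced (λ j → map′ (tt ,_) proj₂ (walk≤? hasse _⋖?_ (suc r) i j)) tw-hasse)

-- Snapshots as unions of components of the Gaifman graph.

module _ (G : DynamicGraph) where
  open DynamicGraph G
  open LocalTreewidthPreserving G hiding (𝒜)

  private
    𝒢 = gaifman (𝒜 G)

  -- The edges of 𝒢 up to orientation; the unary relations contribute none.

  data Link : Rel Element 0ℓ where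
    edge : ∀ {t a b} → IsEdgeAt t a b → Link a b
    succ : ∀ {a b} → Succession a b → Link a b

  Adj-𝒢⇒Link : ∀ {a b} → Adj 𝒢 a b → SymClosure Link a b
  Adj-𝒢⇒Link = Sym.fold (Sym.symmetric Link) E⇒Link
    where
    orient : ∀ {a b x y} → a ≢ b → a ∈ᵛ x ∷ y ∷ [] → b ∈ᵛ x ∷ y ∷ [] → Link x y → SymClosure Link a b
    orient a≢b (here refl)         (here refl)         _ = contradiction refl a≢b
    orient a≢b (here refl)         (there (here refl)) l = fwd l
    orient a≢b (there (here refl)) (here refl)         l = bwd l
    orient a≢b (there (here refl)) (there (here refl)) _ = contradiction refl a≢b

    E⇒Link : ∀ {a b} → E 𝒢 a b → SymClosure Link a b
    E⇒Link (a≢b , `V , _ ∷ [] , _ , here refl , here refl)    = contradiction refl a≢b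
    E⇒Link (a≢b , `T , _ ∷ [] , _ , here refl , here refl)    = contradiction refl a≢b
    E⇒Link (a≢b , `L₁ _ , _ ∷ [] , _ , here refl , here refl) = contradiction refl a≢b
    E⇒Link (a≢b , `E , _ ∷ _ ∷ [] , (_ , e) , a∈ , b∈)        = orient a≢b a∈ b∈ (edge e)
    E⇒Link (a≢b , `R , _ ∷ _ ∷ [] , σ , a∈ , b∈)              = orient a≢b a∈ b∈ (succ σ)
    E⇒Link (a≢b , `L₂ _ , _ ∷ _ ∷ [] , e , a∈ , b∈)           = orient a≢b a∈ b∈ (edge e)

  -- A relation and not a function, because `u` has a copy at `t` only if it exists then.
  data _at_↦_ (u : Vertex) (t : Time) : Element → Set where
    at : (p : t ∈ˢ ζᵥ u) → u at t ↦ vertex u t p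

  -- A link at a copy made at time `t` is an edge of that same time, as `Succession` never touches
  -- vertex elements; so the copies at `t` are closed under adjacency and mirror the snapshot.
  tw-snapshot : ∀ {v t p k} r → tw[ snapshot G t [ N (snapshot G t) r v ] ]≤ k →
                tw[ 𝒢 [ N 𝒢 r (vertex v t p) ] ]≤ k
  tw-snapshot {t = t} {p} r = tw-component {_↦_ = _at t ↦_}
    -- Two copies could differ only in the existence proof, and proofs of a Boolean condition are
    -- unique.
    (λ { (at p) (at q) → cong (vertex _ t) (T-irrelevant p q) })
    (λ { (at _) (at _) → refl })
    (λ p → _ , at p)
    (λ { (at p) → p , tt })
    lift (λ e → reflect (Adj-𝒢⇒Link e))
    r (at p)
    where
    𝒢-edge : ∀ {u v} ((e , t∈e) : E (snapshot G t) u v) p q → E 𝒢 (vertex u t p) (vertex v t q)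
    𝒢-edge (e , t∈e) p q =
      (λ { refl → Edge-loopless e }) , `L₂ t , _ , isEdgeAt e t∈e , here refl , there (here refl)

    lift : Simulates (_at t ↦_) (snapshot G t) 𝒢
    lift (fwd e) (at p) = let q = proj₂ (E⊆V×V (snapshot G t) e) in _ , at q , fwd (𝒢-edge e p q)
    lift (bwd e) (at p) = let q = proj₁ (E⊆V×V (snapshot G t) e) in _ , at q , bwd (𝒢-edge e q p)

    reflect : ∀ {b b′ a} → SymClosure Link b b′ → a at t ↦ b →
              ∃[ a′ ] (a′ at t ↦ b′ × Adj (snapshot G t) a a′)
    reflect (fwd (edge (isEdgeAt {q = q} e t∈e))) (at _) = _ , at q , fwd (e , t∈e)
    reflect (bwd (edge (isEdgeAt {p = q} e t∈e))) (at _) = _ , at q , bwd (e , t∈e)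
    reflect (fwd (succ ())) (at _)
    reflect (bwd (succ ())) (at _)

  -- The path of `s` and the times.

  module TimePath (<ₜ-sto : IsStrictTotalOrder _≡_ _<ₜ_) where
    module <ₜ = IsStrictTotalOrder <ₜ-sto
    open Inverse (proj₂ Time-finite) using (to; from; strictlyInverseʳ; strictlyInverseˡ)

    size = proj₁ Time-finite

    element : Fin (suc size) → Element
    element zero    = s
    element (suc i) = time (from i)

    from-injective : ∀ {i j} → from i ≡ from j → i ≡ j
    from-injective {i} {j} eq =
      trans (sym (strictlyInverseˡ i)) (trans (cong to eq) (strictlyInverseˡ j))

    element-injective : ∀ {i j} → element i ≡ element j → i ≡ j
    element-injective {zero}  {zero}  _  = refl
    element-injective {suc i} {suc j} eq = cong suc (from-injective (time-injective eq))
      where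
      time-injective : ∀ {t t′} → time t ≡ time t′ → t ≡ t′
      time-injective refl = refl

    time≡element : ∀ t → time t ≡ element (suc (to t))
    time≡element t = cong time (sym (strictlyInverseʳ t))

    -- The enumeration of `Time` by `Fin size` need not follow `_<ₜ_`, so the order is pulled back
    -- along `from`, with `s` adjoined as least element.
    data _⊏_ : Rel (Fin (suc size)) 0ℓ where
      s⊏    : ∀ {j} → zero ⊏ suc j
      time⊏ : ∀ {i j} → from i <ₜ from j → suc i ⊏ suc j

    ⊏-trans : Transitive _⊏_
    ⊏-trans s⊏        (time⊏ _) = s⊏
    ⊏-trans (time⊏ p) (time⊏ q) = time⊏ (<ₜ.trans p q)

    ⊏-compare : Trichotomous _≡_ _⊏_
    ⊏-compare zero    zero    = tri≈ (λ ()) refl (λ ())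
    ⊏-compare zero    (suc j) = tri< s⊏ (λ ()) (λ ())
    ⊏-compare (suc i) zero    = tri> (λ ()) (λ ()) s⊏
    ⊏-compare (suc i) (suc j) with <ₜ.compare (from i) (from j)
    ... | tri< lt ≢ ≯ = tri< (time⊏ lt) (λ { refl → ≢ refl }) (λ { (time⊏ gt) → ≯ gt })
    ... | tri≈ ≮ eq ≯ = tri≈ (λ { (time⊏ lt) → ≮ lt }) (cong suc (from-injective eq)) (λ { (time⊏ gt) → ≯ gt })
    ... | tri> ≮ ≢ gt = tri> (λ { (time⊏ lt) → ≮ lt }) (λ { refl → ≢ refl }) (time⊏ gt)

    ⊏-isStrictTotalOrder : IsStrictTotalOrder _≡_ _⊏_
    ⊏-isStrictTotalOrder = isStrictTotalOrderᶜ record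
      { isEquivalence = isEquivalence ; trans = ⊏-trans ; compare = ⊏-compare }

    open FiniteChain ⊏-isStrictTotalOrder

    -- Adjoining `s` merges both clauses of `R` into covering: an index covers `zero` when no time
    -- lies below it, which by totality means `Earliest`.
    ⋖⇒Succession : ∀ {i j} → i ⋖ j → Succession (element i) (element j)
    ⋖⇒Succession {j = suc j} (s⊏ , ¬between) = first earliest
      where
      earliest : Earliest (from j)
      earliest t t≢j with <ₜ.compare (from j) t
      ... | tri< j<t _ _ = j<t
      ... | tri≈ _ j≡t _ = contradiction (sym j≡t) t≢j
      ... | tri> _ _ t<j = contradiction
        (suc (to t) , s⊏ , time⊏ (subst (_<ₜ from j) (sym (strictlyInverseʳ t)) t<j)) ¬between
    ⋖⇒Succession {suc i} {suc j} (time⊏ i<j , ¬between) = next (i<j , λ t (i<t , t<j) →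
      ¬between (suc (to t) , time⊏ (subst (from i <ₜ_) (sym (strictlyInverseʳ t)) i<t)
                           , time⊏ (subst (_<ₜ from j) (sym (strictlyInverseʳ t)) t<j)))

    Succession⇒⋖ : ∀ i j → Succession (element i) (element j) → i ⋖ j
    Succession⇒⋖ zero    (suc j) (first earliest)        = s⊏ , λ { (_ , s⊏ , time⊏ k<j) →
      <ₜ.asym k<j (earliest _ (λ k≡j → <ₜ.irrefl k≡j k<j)) }
    Succession⇒⋖ (suc i) (suc j) (next (i<j , ¬between)) = time⊏ i<j , λ { (_ , time⊏ i<k , time⊏ k<j) →
      ¬between _ (i<k , k<j) }

    Succession⇒elements : ∀ {a b} → Succession a b → ∃[ i ] ∃[ j ] (a ≡ element i × b ≡ element j)
    Succession⇒elements (next {t₁} {t₂} _) = _ , _ , time≡element t₁ , time≡element t₂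
    Succession⇒elements (first {t} _)      = zero , _ , refl , time≡element t

    -- Edges of snapshots never touch `s` or a time, so every link at a path element is a succession
    -- and its other end is again on the path.
    tw-element : ∀ i r {k} → tw[ hasse [ N hasse r i ] ]≤ k → tw[ 𝒢 [ N 𝒢 r (element i) ] ]≤ k
    tw-element i r = tw-component {_↦_ = λ i a → a ≡ element i}
      (λ { refl refl → refl })
      (λ a≡ a≡′ → element-injective (trans (sym a≡) a≡′))
      (λ {i} _ → element i , refl)
      (λ _ → tt , tt)
      lift (λ e → reflect (Adj-𝒢⇒Link e))
      r refl
      where
      𝒢-edge : ∀ {i j} → i ⋖ j → E 𝒢 (element i) (element j)
      𝒢-edge {i} i⋖j = (λ eq → loopless hasse (subst (i ⋖_) (sym (element-injective eq)) i⋖j)) ,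
                       `R , _ , ⋖⇒Succession i⋖j , here refl , there (here refl)

      lift : Simulates (λ i a → a ≡ element i) hasse 𝒢
      lift (fwd e) refl = _ , refl , fwd (𝒢-edge e)
      lift (bwd e) refl = _ , refl , bwd (𝒢-edge e)

      reflect : ∀ {b b′ i} → SymClosure Link b b′ → b ≡ element i →
                ∃[ j ] (b′ ≡ element j × Adj hasse i j)
      reflect {i = zero}  (fwd (edge ())) refl
      reflect {i = zero}  (bwd (edge ())) refl
      reflect {i = suc _} (fwd (edge ())) refl
      reflect {i = suc _} (bwd (edge ())) refl
      reflect {i = i} (fwd (succ σ)) refl with Succession⇒elements σ
      ... | _ , j , _ , refl = j , refl , fwd (Succession⇒⋖ i j σ)
      reflect {i = i} (bwd (succ σ)) refl with Succession⇒elements σ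
      ... | j , _ , refl , _ = j , refl , bwd (Succession⇒⋖ j i σ)

    ltw-time : (f : ℕ → ℕ) → (∀ r → 1 ≤ r → 1 ≤ f r) → ∀ i r → tw[ 𝒢 [ N 𝒢 r (element i) ] ]≤ f r
    ltw-time f 1≤f i r = tw-element i r (ltw-hasse {f} 1≤f r i tt)

theorem5 : (G : DynamicGraph) → let open DynamicGraph G in
    IsStrictTotalOrder _≡_ _<ₜ_ →
    (f : ℕ → ℕ) → (∀ r → 1 ≤ r → 1 ≤ f r) →
    (∀ t r → ltw[ snapshot G t , r ]≤ f r) →
    ∀ r → ltw[ gaifman (𝒜 G) , r ]≤ f r
theorem5 G <ₜ-sto f 1≤f ltw-snapshots r = λ
  { (vertex v t p) _ → tw-snapshot G r (ltw-snapshots t r v p)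
  ; (time t)       _ → subst (λ a → tw[ 𝒢 [ N 𝒢 r a ] ]≤ f r) (sym (time≡element t))
                             (ltw-time f 1≤f _ r)
  ; s              _ → ltw-time f 1≤f zero r
  }
  where
  𝒢 = gaifman (𝒜 G)
  open LocalTreewidthPreserving G using (vertex; time; s)
  open TimePath G <ₜ-sto
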